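{- Let $(u_1, u_2, u_3)$ be a Büchi triple. Then there exist non-negative integers $s_1, s_3, s_4, s_6$ and $\beta \in \{1,2\}$ satisfying $s_1 s_3 - s_4 s_6 = \beta$, such that \[u_1 = \frac{s_1 s_3 - s_3 s_4 + s_1 s_6 + s_4 s_6}{\beta}, \quad u_2 = \frac{s_3 s_4 + s_1 s_6}{\beta}, \quad u_3 = \frac{s_1 s_3 + s_3 s_4 - s_1 s_6 + s_4 s_6}{\beta}.\]
   Context: A Büchi $n$-tuple is an $n$-tuple $(u_1, \dots, u_n)$ of positive integers such that $u_1^2, \dots, u_n^2$ is an increasing sequence of squares with second difference equal to $2$, i.e. $u_{k+2}^2 - 2u_{k+1}^2 + u_k^2 = 2$ for $1 \le k \le n-2$. A Büchi triple is a Büchi $3$-tuple. -}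

module Defs where

open import Data.Fin.Base using (Fin; toℕ) renaming (_<_ to _<ᶠ_)
open import Data.Integer.Base using (+_; _+_; _-_; _*_; _^_; _<_)
open import Data.Nat.Base as ℕ using (ℕ; suc; NonZero)
open import Data.Sum.Base using (_⊎_; inj₁; inj₂)
open import Data.Vec.Base using (Vec; lookup)
open import Relation.Binary.PropositionalEquality using (_≡_; refl)

-- Indices are 0-based; the second-difference condition quantifies over
-- triples of consecutive indices, so it is vacuous for n < 3.
record IsBüchiTuple {n : ℕ} (u : Vec ℕ n) : Set where
  field
    positive : ∀ i → 0 ℕ.< lookup u i
    increasing : ∀ i j → i <ᶠ j →
      (+ lookup u i) ^ 2 < (+ lookup u j) ^ 2
    second-difference : ∀ (i j k : Fin n) →
      toℕ j ≡ suc (toℕ i) → toℕ k ≡ suc (toℕ j) →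
      (+ lookup u k) ^ 2 - + 2 * (+ lookup u j) ^ 2 + (+ lookup u i) ^ 2 ≡ + 2

IsBüchiTriple : Vec ℕ 3 → Set
IsBüchiTriple = IsBüchiTuple

OneOrTwo : ℕ → Set
OneOrTwo β = β ≡ 1 ⊎ β ≡ 2

oneOrTwo⇒nonZero : ∀ {β} → OneOrTwo β → NonZero β
oneOrTwo⇒nonZero (inj₁ refl) = _
oneOrTwo⇒nonZero (inj₂ refl) = _

{-# OPTIONS --safe #-}
-- With p = (u₁ + u₃) / 2 and q = (u₃ - u₁) / 2, which are integers because
-- u₁ and u₃ have the same parity, the Büchi condition becomes
-- p² + q² = u₂² + 1, that is (p + 1)(p - 1) = (u₂ + q)(u₂ - q).
-- The four number theorem refines the two factorizations to
-- p + 1 = s₁s₃, p - 1 = s₄s₆, u₂ + q = s₃s₄, u₂ - q = s₁s₆,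
-- and this is the required parametrization, always with β = 2.
module Submission where

open import Data.Fin.Base using (zero; suc)
open import Data.Integer.Base using (ℤ; +_; 0ℤ; _+_; _-_; _*_; _^_; _≤_; _<_; +≤+)
import Data.Integer.Properties as ℤ
import Data.Integer.Tactic.RingSolver as ℤ-Ring
open import Data.Nat.Base as ℕ using (ℕ; suc; NonZero; ≢-nonZero; z≤n; z<s)
open import Data.Nat.Coprimality using (coprime-divisor; coprime-/gcd)
open import Data.Nat.Divisibility using (_∣_; divides; ∣m+n∣m⇒∣n; m∣m*n)
open import Data.Nat.DivMod using (m/n*n≡m)
open import Data.Nat.GCD
  using (gcd; gcd[m,n]∣m; gcd[m,n]∣n; gcd[m,n]≢0; m/gcd[m,n]≢0)
open import Data.Nat.Primality using (euclidsLemma; prime[2])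
import Data.Nat.Properties as ℕ
import Data.Nat.Tactic.RingSolver as ℕ-Ring
open import Data.Product.Base using (Σ-syntax; ∃-syntax; _×_; _,_)
open import Data.Rational.Base using (_/_)
open import Data.Rational.Properties using (fromℚᵘ-cong)
import Data.Rational.Unnormalised.Base as ℚᵘ
open import Data.Sum.Base using (inj₁; inj₂; reduce)
open import Data.Vec.Base using ([]; _∷_)
open import Relation.Binary.PropositionalEquality
  using (_≡_; refl; sym; trans; cong; cong₂; subst; subst₂; module ≡-Reasoning)
open import Defs

open ≡-Reasoning

-- Dividing `a` and `c` by `g`, their gcd, leaves coprime `a′` and `c′` with `a′ * b ≡ c′ * d`, so
-- `a′` divides `d`. The factors are `a′`, `g`, `c′` and the quotient `e` of `d` by `a′`. Since `a`
-- is nonzero, both `g` and `a′` can be cancelled.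
four-number : ∀ a b c d .{{_ : NonZero a}} → a ℕ.* b ≡ c ℕ.* d →
  ∃[ s₁ ] ∃[ s₃ ] ∃[ s₄ ] ∃[ s₆ ]
    a ≡ s₁ ℕ.* s₃ × b ≡ s₄ ℕ.* s₆ × c ≡ s₃ ℕ.* s₄ × d ≡ s₁ ℕ.* s₆
four-number a@(suc _) b c d ab≡cd =
  factor (coprime-divisor (coprime-/gcd a c) (divides b (trans (sym a′b≡c′d) (ℕ.*-comm a′ b))))
  where
  g = gcd a c
  instance
    g≢0 : NonZero g
    g≢0 = ≢-nonZero (gcd[m,n]≢0 a c (inj₁ λ ()))
  a′ = a ℕ./ g
  c′ = c ℕ./ g
  instance
    a′≢0 : NonZero a′
    a′≢0 = ≢-nonZero (m/gcd[m,n]≢0 a c)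
  a′g≡a : a′ ℕ.* g ≡ a
  a′g≡a = m/n*n≡m (gcd[m,n]∣m a c)
  c′g≡c : c′ ℕ.* g ≡ c
  c′g≡c = m/n*n≡m (gcd[m,n]∣n a c)
  swap-middle : ∀ x y z → x ℕ.* y ℕ.* z ≡ x ℕ.* z ℕ.* y
  swap-middle = ℕ-Ring.solve-∀
  swap-outer : ∀ x y z → x ℕ.* (y ℕ.* z) ≡ z ℕ.* (x ℕ.* y)
  swap-outer = ℕ-Ring.solve-∀
  a′b≡c′d : a′ ℕ.* b ≡ c′ ℕ.* d
  a′b≡c′d = ℕ.*-cancelʳ-≡ _ _ g (begin
    a′ ℕ.* b ℕ.* g  ≡⟨ swap-middle a′ b g ⟩
    a′ ℕ.* g ℕ.* b  ≡⟨ cong (ℕ._* b) a′g≡a ⟩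
    a ℕ.* b         ≡⟨ ab≡cd ⟩
    c ℕ.* d         ≡⟨ cong (ℕ._* d) c′g≡c ⟨
    c′ ℕ.* g ℕ.* d  ≡⟨ swap-middle c′ g d ⟩
    c′ ℕ.* d ℕ.* g  ∎)
  factor : a′ ∣ d → ∃[ s₁ ] ∃[ s₃ ] ∃[ s₄ ] ∃[ s₆ ]
    a ≡ s₁ ℕ.* s₃ × b ≡ s₄ ℕ.* s₆ × c ≡ s₃ ℕ.* s₄ × d ≡ s₁ ℕ.* s₆
  factor (divides e d≡ea′) =
    a′ , g , c′ , e , sym a′g≡a
    , ℕ.*-cancelˡ-≡ b _ a′ (begin
        a′ ℕ.* b           ≡⟨ a′b≡c′d ⟩
        c′ ℕ.* d           ≡⟨ cong (c′ ℕ.*_) d≡ea′ ⟩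
        c′ ℕ.* (e ℕ.* a′)  ≡⟨ swap-outer c′ e a′ ⟩
        a′ ℕ.* (c′ ℕ.* e)  ∎)
    , trans (sym c′g≡c) (ℕ.*-comm c′ g)
    , trans d≡ea′ (ℕ.*-comm e a′)

-- Moving the negative term across removes subtraction, so the rest of the argument can run in `ℕ`.
second-difference-ℕ : ∀ a b c →
  (+ c) ^ 2 - + 2 * (+ b) ^ 2 + (+ a) ^ 2 ≡ + 2 →
  c ℕ.* c ℕ.+ a ℕ.* a ≡ 2 ℕ.+ 2 ℕ.* (b ℕ.* b)
second-difference-ℕ a b c eq = ℤ.+-injective (begin
  + (c ℕ.* c) + + (a ℕ.* a)  ≡⟨ cong₂ _+_ (ℤ.pos-* c c) (ℤ.pos-* a a) ⟩
  + c * + c + + a * + a      ≡⟨ isolate (+ a) (+ b) (+ c) ⟩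
  ((+ c) ^ 2 - + 2 * (+ b) ^ 2 + (+ a) ^ 2) + + 2 * (+ b * + b)
                             ≡⟨ cong (_+ + 2 * (+ b * + b)) eq ⟩
  + 2 + + 2 * (+ b * + b)    ≡⟨ cong (λ n → + 2 + + 2 * n) (ℤ.pos-* b b) ⟨
  + 2 + + 2 * + (b ℕ.* b)    ≡⟨ cong (_+_ (+ 2)) (ℤ.pos-* 2 (b ℕ.* b)) ⟨
  + (2 ℕ.+ 2 ℕ.* (b ℕ.* b))  ∎)
  where
  -- The products ending in `+ 1` are the form to which `_^ 2` unfolds.
  isolate : ∀ x y z → z * z + x * x ≡
    (z * (z * + 1) - + 2 * (y * (y * + 1)) + x * (x * + 1)) + + 2 * (y * y)
  isolate = ℤ-Ring.solve-∀

-- This is the parity claim for `k` = u₃ - u₁: expanding the left side gives an even number plus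
-- `k * k`, so the prime 2 divides `k * k` and hence `k`.
even-gap : ∀ a k n → (a ℕ.+ k) ℕ.* (a ℕ.+ k) ℕ.+ a ℕ.* a ≡ 2 ℕ.* n →
  ∃[ q ] k ≡ q ℕ.+ q
even-gap a k n eq with reduce (euclidsLemma k k prime[2] 2∣k²)
  where
  expand : ∀ x y → (x ℕ.+ y) ℕ.* (x ℕ.+ y) ℕ.+ x ℕ.* x ≡
    2 ℕ.* (x ℕ.* x ℕ.+ x ℕ.* y) ℕ.+ y ℕ.* y
  expand = ℕ-Ring.solve-∀
  2∣k² : 2 ∣ k ℕ.* k
  2∣k² = ∣m+n∣m⇒∣n
    (subst (2 ∣_) (trans (sym eq) (expand a k)) (m∣m*n n))
    (m∣m*n (a ℕ.* a ℕ.+ a ℕ.* k))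
... | divides q k≡q2 = q , trans k≡q2 (double q)
  where
  double : ∀ x → x ℕ.* 2 ≡ x ℕ.+ x
  double = ℕ-Ring.solve-∀

pos-square : ∀ n → (+ n) ^ 2 ≡ + (n ℕ.* n)
pos-square n = trans (cong (+ n *_) (ℤ.*-identityʳ (+ n))) (sym (ℤ.pos-* n n))

square-cancel-≤ : ∀ m n → m ℕ.* m ℕ.≤ n ℕ.* n → m ℕ.≤ n
square-cancel-≤ m n m²≤n² =
  ℕ.≮⇒≥ λ n<m → ℕ.<⇒≱ (ℕ.*-mono-< n<m n<m) m²≤n²

halve : ∀ u {x} → x ≡ + 2 * + u → + u / 1 ≡ x / 2
-- Equality is checked by cross-multiplication of unnormalised fractions; `mkℚᵘ` stores the
-- denominator minus one, so 0 and 1 stand for denominators 1 and 2.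
halve u {x} x≡2u = fromℚᵘ-cong {ℚᵘ.mkℚᵘ (+ u) 0} {ℚᵘ.mkℚᵘ x 1}
  (ℚᵘ.*≡* (trans (ℤ.*-comm (+ u) (+ 2)) (trans (sym x≡2u) (sym (ℤ.*-identityʳ x)))))


-- Here u₁ = p - q and u₃ = p + q with p = 1 + m + q, so the squares sum to 2(p² + q²). Writing p²
-- as (p + 1)(p - 1) + 1 absorbs the constant 2; p - 1 = m + q stays natural.
halve-equation : ∀ m q n →
  (suc m ℕ.+ (q ℕ.+ q)) ℕ.* (suc m ℕ.+ (q ℕ.+ q)) ℕ.+ suc m ℕ.* suc m
    ≡ 2 ℕ.+ 2 ℕ.* n →
  (2 ℕ.+ (m ℕ.+ q)) ℕ.* (m ℕ.+ q) ℕ.+ q ℕ.* q ≡ n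
halve-equation m q n eq = ℕ.*-cancelˡ-≡ _ n 2
  (ℕ.+-cancelˡ-≡ 2 _ _ (trans (sym (expand m q)) eq))
  where
  expand : ∀ x y →
    (1 ℕ.+ x ℕ.+ (y ℕ.+ y)) ℕ.* (1 ℕ.+ x ℕ.+ (y ℕ.+ y)) ℕ.+ (1 ℕ.+ x) ℕ.* (1 ℕ.+ x)
      ≡ 2 ℕ.+ 2 ℕ.* ((2 ℕ.+ (x ℕ.+ y)) ℕ.* (x ℕ.+ y) ℕ.+ y ℕ.* y)
  expand = ℕ-Ring.solve-∀

-- With u₂ written as `q + d`, the factors u₂ + q and u₂ - q become `q + d + q` and `d`, with no
-- truncated subtraction.
difference-of-squares : ∀ n q d → n ℕ.+ q ℕ.* q ≡ (q ℕ.+ d) ℕ.* (q ℕ.+ d) →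
  n ≡ (q ℕ.+ d ℕ.+ q) ℕ.* d
difference-of-squares n q d eq = ℕ.+-cancelʳ-≡ (q ℕ.* q) n _ (trans eq (expand q d))
  where
  expand : ∀ x y → (x ℕ.+ y) ℕ.* (x ℕ.+ y) ≡ (x ℕ.+ y ℕ.+ x) ℕ.* y ℕ.+ x ℕ.* x
  expand = ℕ-Ring.solve-∀

-- Here u₁ = 1 + m, u₂ = q + d and u₃ = 1 + m + 2q.
recombine : ∀ m q d {s₁s₃ s₄s₆ s₃s₄ s₁s₆ : ℤ} →
  s₁s₃ ≡ + 2 + (m + q) → s₄s₆ ≡ m + q → s₃s₄ ≡ q + d + q → s₁s₆ ≡ d →
  s₁s₃ - s₄s₆ ≡ + 2
  × s₁s₃ - s₃s₄ + s₁s₆ + s₄s₆ ≡ + 2 * (+ 1 + m)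
  × s₃s₄ + s₁s₆ ≡ + 2 * (q + d)
  × s₁s₃ + s₃s₄ - s₁s₆ + s₄s₆ ≡ + 2 * (+ 1 + m + (q + q))
recombine m q d refl refl refl refl =
  β-identity m q , u₁-identity m q d , u₂-identity q d , u₃-identity m q d
  where
  β-identity : ∀ m q → (+ 2 + (m + q)) - (m + q) ≡ + 2
  β-identity = ℤ-Ring.solve-∀
  u₁-identity : ∀ m q d →
    (+ 2 + (m + q)) - (q + d + q) + d + (m + q) ≡ + 2 * (+ 1 + m)
  u₁-identity = ℤ-Ring.solve-∀
  u₂-identity : ∀ q d → (q + d + q) + d ≡ + 2 * (q + d)
  u₂-identity = ℤ-Ring.solve-∀
  u₃-identity : ∀ m q d →
    (+ 2 + (m + q)) + (q + d + q) - d + (m + q) ≡ + 2 * (+ 1 + m + (q + q))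
  u₃-identity = ℤ-Ring.solve-∀

+-product : ∀ s t {n} → n ≡ s ℕ.* t → + s * + t ≡ + n
+-product s t n≡st = trans (sym (ℤ.pos-* s t)) (cong +_ (sym n≡st))

-- The case β = 2 with denominators cleared; natural parameters make non-negativity automatic.
IntegralParametrization : ℕ → ℕ → ℕ → Set
IntegralParametrization u₁ u₂ u₃ =
  ∃[ s₁ ] ∃[ s₃ ] ∃[ s₄ ] ∃[ s₆ ]
    + s₁ * + s₃ - + s₄ * + s₆ ≡ + 2
    × + s₁ * + s₃ - + s₃ * + s₄ + + s₁ * + s₆ + + s₄ * + s₆ ≡ + 2 * + u₁
    × + s₃ * + s₄ + + s₁ * + s₆ ≡ + 2 * + u₂
    × + s₁ * + s₃ + + s₃ * + s₄ - + s₁ * + s₆ + + s₄ * + s₆ ≡ + 2 * + u₃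

parametrize-even-gap : ∀ m q u₂ {k} → k ≡ q ℕ.+ q →
  (suc m ℕ.+ k) ℕ.* (suc m ℕ.+ k) ℕ.+ suc m ℕ.* suc m ≡ 2 ℕ.+ 2 ℕ.* (u₂ ℕ.* u₂) →
  IntegralParametrization (suc m) u₂ (suc m ℕ.+ k)
parametrize-even-gap m q u₂ refl eq
  -- The halved equation exhibits u₂² as a natural number plus q², so q ≤ u₂ and `d` is the
  -- difference.
  with d , refl ← ℕ.m≤n⇒∃[o]m+o≡n (square-cancel-≤ q u₂
         (subst (q ℕ.* q ℕ.≤_) (halve-equation m q (u₂ ℕ.* u₂) eq) (ℕ.m≤n+m (q ℕ.* q) _)))
  = let
      s₁ , s₃ , s₄ , s₆ , p+1≡s₁s₃ , p-1≡s₄s₆ , u₂+q≡s₃s₄ , u₂-q≡s₁s₆ =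
        four-number (2 ℕ.+ (m ℕ.+ q)) (m ℕ.+ q) (q ℕ.+ d ℕ.+ q) d
          (difference-of-squares _ q d (halve-equation m q ((q ℕ.+ d) ℕ.* (q ℕ.+ d)) eq))
    in s₁ , s₃ , s₄ , s₆
       , recombine (+ m) (+ q) (+ d)
           (+-product s₁ s₃ p+1≡s₁s₃) (+-product s₄ s₆ p-1≡s₄s₆)
           (+-product s₃ s₄ u₂+q≡s₃s₄) (+-product s₁ s₆ u₂-q≡s₁s₆)

integral-parametrization : ∀ u₁ u₂ u₃ → IsBüchiTriple (u₁ ∷ u₂ ∷ u₃ ∷ []) →
  IntegralParametrization u₁ u₂ u₃
integral-parametrization 0 _ _ B with () ← IsBüchiTuple.positive B zero
integral-parametrization u₁@(suc m) u₂ u₃ B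
  -- The squares increase from u₁ to u₃, which makes `k` = u₃ - u₁ a natural number.
  with k , refl ← ℕ.m≤n⇒∃[o]m+o≡n (square-cancel-≤ u₁ u₃
         (ℕ.<⇒≤ (ℤ.drop‿+<+ (subst₂ _<_ (pos-square u₁) (pos-square u₃)
           (IsBüchiTuple.increasing B zero (suc (suc zero)) z<s)))))
  = let
      eq = second-difference-ℕ u₁ u₂ u₃
        (IsBüchiTuple.second-difference B zero (suc zero) (suc (suc zero)) refl refl)
      -- The right side 2 + 2u₂² is regrouped as 2(1 + u₂²) to show that it is even.
      q , k≡q+q = even-gap u₁ k (suc (u₂ ℕ.* u₂)) (trans eq (sym (ℕ.*-suc 2 (u₂ ℕ.* u₂))))
    in parametrize-even-gap m q u₂ k≡q+q eq

theorem1p5 : ∀ (u₁ u₂ u₃ : ℕ) → IsBüchiTriple (u₁ ∷ u₂ ∷ u₃ ∷ []) →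
    Σ[ s₁ ∈ ℤ ] Σ[ s₃ ∈ ℤ ] Σ[ s₄ ∈ ℤ ] Σ[ s₆ ∈ ℤ ] Σ[ β ∈ ℕ ] Σ[ β∈12 ∈ OneOrTwo β ]
    let instance β≢0 = oneOrTwo⇒nonZero β∈12 in
    (0ℤ ≤ s₁ × 0ℤ ≤ s₃ × 0ℤ ≤ s₄ × 0ℤ ≤ s₆)
    × s₁ * s₃ - s₄ * s₆ ≡ + β
    × + u₁ / 1 ≡ (s₁ * s₃ - s₃ * s₄ + s₁ * s₆ + s₄ * s₆) / β
    × + u₂ / 1 ≡ (s₃ * s₄ + s₁ * s₆) / β
    × + u₃ / 1 ≡ (s₁ * s₃ + s₃ * s₄ - s₁ * s₆ + s₄ * s₆) / β
theorem1p5 u₁ u₂ u₃ B =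
  let s₁ , s₃ , s₄ , s₆ , β-eq , u₁-eq , u₂-eq , u₃-eq = integral-parametrization u₁ u₂ u₃ B
  in + s₁ , + s₃ , + s₄ , + s₆ , 2 , inj₂ refl
     , (+≤+ z≤n , +≤+ z≤n , +≤+ z≤n , +≤+ z≤n)
     , β-eq , halve u₁ u₁-eq , halve u₂ u₂-eq , halve u₃ u₃-eq
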